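{- Let $\mathcal A=(S,R)$ be a finitary argumentation network ($S\neq\varnothing$, $R\subseteq S\times S$, each element has finitely many attackers), and let $\Delta_{\mathcal A}$ be the $\mathbf{CN}$-theory $$\Delta_{\mathcal A}=\{x\mid x\in S \text{ unattacked}\}\cup\{y\leftrightarrow \textstyle\bigwedge_{zRy}Nz\mid y\in S\}\cup\{z\to Ny\mid zRy\}\cup\{(\textstyle\bigwedge_{zRy}\neg z)\wedge(\bigvee_{zRy}\neg Nz)\to \neg y\wedge\neg Ny\mid y\in S\}.$$ Let $E=\{x\in S\mid \Delta_{\mathcal A}\vdash_{\mathbf{CN}}x\}$. Then $E$ is the grounded extension of $\mathcal A$.
   Context: The logic $\mathbf{CN}$: the elements of $S$ are basic atoms; atomic formulas are $q$ and $Nq$ for basic atoms $q$; formulas are built with classical connectives; $\Delta\vdash_{\mathbf{CN}}A$ iff $\Delta\cup\{Nq\to\neg q\}\vdash A$ in classical propositional logic (treating each $q$ and $Nq$ as distinct classical atoms). Empty conjunctions are $\top$, empty disjunctions $\bot$. A complete extension of $(S,R)$ is a conflict-free set $E\subseteq S$ (no $x,y\in E$ with $xRy$) which contains exactly those arguments it defends ($x$ is defended by $E$ if every attacker of $x$ is attacked by some element of $E$); equivalently, the set of arguments labelled in by a legitimate Caminada labelling. The grounded (ground) extension is the least complete extension with respect to inclusion. -}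

module Defs where

open import Data.List.Base using (List; _∷_; foldr; map)
open import Data.List.Membership.Propositional using (_∈_)
open import Data.List.Relation.Unary.All using (All)
open import Data.Product.Base using (∃-syntax; _×_; proj₁)
open import Function.Bundles using (_⇔_)
open import Level using (_⊔_; suc; Setω)
open import Relation.Binary.Core using (Rel)
open import Relation.Nullary.Negation.Core using (¬_)
open import Relation.Unary using (Pred; _⊆_; _∪_)

infixr 7 _∧ᶠ_
infixr 6 _∨ᶠ_
infixr 5 _⇒ᶠ_

data Formula {a} (Atom : Set a) : Set a where
  atom           : Atom → Formula Atom
  ⊤ᶠ ⊥ᶠ          : Formula Atom
  _∧ᶠ_ _∨ᶠ_ _⇒ᶠ_ : Formula Atom → Formula Atom → Formula Atom

module _ {a} {Atom : Set a} where

  infix 8 ¬ᶠ_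
  infix 4 _⇔ᶠ_

  ¬ᶠ_ : Formula Atom → Formula Atom
  ¬ᶠ A = A ⇒ᶠ ⊥ᶠ

  _⇔ᶠ_ : Formula Atom → Formula Atom → Formula Atom
  A ⇔ᶠ B = (A ⇒ᶠ B) ∧ᶠ (B ⇒ᶠ A)

  ⋀ ⋁ : List (Formula Atom) → Formula Atom
  ⋀ = foldr _∧ᶠ_ ⊤ᶠ
  ⋁ = foldr _∨ᶠ_ ⊥ᶠ

  infix 3 _⊢ᴺ_ _⊢_

  -- Natural deduction from finitely many assumptions; `raa` makes it classical.
  data _⊢ᴺ_ (Γ : List (Formula Atom)) : Formula Atom → Set a where
    hyp : ∀ {A} → A ∈ Γ → Γ ⊢ᴺ A
    ⊤I  : Γ ⊢ᴺ ⊤ᶠ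
    ∧I  : ∀ {A B} → Γ ⊢ᴺ A → Γ ⊢ᴺ B → Γ ⊢ᴺ A ∧ᶠ B
    ∧E₁ : ∀ {A B} → Γ ⊢ᴺ A ∧ᶠ B → Γ ⊢ᴺ A
    ∧E₂ : ∀ {A B} → Γ ⊢ᴺ A ∧ᶠ B → Γ ⊢ᴺ B
    ∨I₁ : ∀ {A B} → Γ ⊢ᴺ A → Γ ⊢ᴺ A ∨ᶠ B
    ∨I₂ : ∀ {A B} → Γ ⊢ᴺ B → Γ ⊢ᴺ A ∨ᶠ B
    ∨E  : ∀ {A B C} → Γ ⊢ᴺ A ∨ᶠ B → A ∷ Γ ⊢ᴺ C → B ∷ Γ ⊢ᴺ C → Γ ⊢ᴺ C
    ⇒I  : ∀ {A B} → A ∷ Γ ⊢ᴺ B → Γ ⊢ᴺ A ⇒ᶠ B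
    ⇒E  : ∀ {A B} → Γ ⊢ᴺ A ⇒ᶠ B → Γ ⊢ᴺ A → Γ ⊢ᴺ B
    raa : ∀ {A} → ¬ᶠ A ∷ Γ ⊢ᴺ ⊥ᶠ → Γ ⊢ᴺ A

  -- A possibly infinite theory proves what some finite list of its members does.
  _⊢_ : ∀ {ℓ} → Pred (Formula Atom) ℓ → Formula Atom → Set (a ⊔ ℓ)
  Δ ⊢ A = ∃[ Γ ] All Δ Γ × Γ ⊢ᴺ A

data CNAtom {s} (S : Set s) : Set s where
  basic N : S → CNAtom S

module _ {s} {S : Set s} where

  infix 3 _⊢CN_

  ⟨_⟩ 𝐍 : S → Formula (CNAtom S)
  ⟨ q ⟩ = atom (basic q)
  𝐍 q   = atom (N q)

  data CNAxiom : Pred (Formula (CNAtom S)) s where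
    N⇒¬ : ∀ q → CNAxiom (𝐍 q ⇒ᶠ ¬ᶠ ⟨ q ⟩)

  _⊢CN_ : ∀ {ℓ} → Pred (Formula (CNAtom S)) ℓ → Formula (CNAtom S) → Set (s ⊔ ℓ)
  Δ ⊢CN A = Δ ∪ CNAxiom ⊢ A

record Network s r : Set (suc (s ⊔ r)) where
  field
    S        : Set s
    R        : Rel S r
    nonempty : S

module _ {s r} (𝒜 : Network s r) where

  open Network 𝒜

  -- The attackers of each element are exactly the members of some list.
  Finitary : Set (s ⊔ r)
  Finitary = ∀ y → ∃[ zs ] (∀ z → z ∈ zs ⇔ R z y)

  Unattacked : Pred S (s ⊔ r)
  Unattacked x = ∀ z → ¬ R z x

  Defends : ∀ {ℓ} → Pred S ℓ → Pred S (s ⊔ r ⊔ ℓ)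
  Defends E x = ∀ z → R z x → ∃[ y ] E y × R y z

  record IsComplete {ℓ} (E : Pred S ℓ) : Set (s ⊔ r ⊔ ℓ) where
    field
      conflictFree : ∀ {x y} → E x → E y → ¬ R x y
      fixedPoint   : ∀ x → E x ⇔ Defends E x

  -- Lives in Setω because E is compared with complete extensions of every level.
  record IsGrounded {ℓ} (E : Pred S ℓ) : Setω where
    field
      complete : IsComplete E
      least    : ∀ {ℓ′} (E′ : Pred S ℓ′) → IsComplete E′ → E ⊆ E′

  module _ (fin : Finitary) where

    attackers : S → List S
    attackers y = proj₁ (fin y)

    data Theory : Pred (Formula (CNAtom S)) (s ⊔ r) where
      unattacked : ∀ {x} → Unattacked x → Theory ⟨ x ⟩
      in-iff     : ∀ y → Theory (⟨ y ⟩ ⇔ᶠ ⋀ (map 𝐍 (attackers y)))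
      attack     : ∀ {z y} → R z y → Theory (⟨ z ⟩ ⇒ᶠ 𝐍 y)
      undecided  : ∀ y → Theory
        (⋀ (map (λ z → ¬ᶠ ⟨ z ⟩) (attackers y)) ∧ᶠ ⋁ (map (λ z → ¬ᶠ 𝐍 z) (attackers y))
          ⇒ᶠ ¬ᶠ ⟨ y ⟩ ∧ᶠ ¬ᶠ 𝐍 y)

{-# OPTIONS --safe #-}
-- The grounded extension is the least fixed point G of "being defended".  An
-- induction on G shows that its members are provable.  Conversely, reading q as
-- "q ∈ G" and N q as "some member of G attacks q" gives a model of the theory.
-- As membership in G is not decidable, the model is a double-negation
-- interpretation in which falsity is an arbitrary type F (Friedman's trick):
-- taking F = G x turns a proof of x into a double F-negation of G x, hence G x.
module Submission where

open import Data.Empty using (⊥-elim)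
open import Data.List.Base using (List; []; _∷_; _++_; map)
open import Data.List.Membership.Propositional using (_∈_)
open import Data.List.Relation.Binary.Subset.Propositional using () renaming (_⊆_ to _⊆ᴸ_)
open import Data.List.Relation.Binary.Subset.Propositional.Properties
  using (∷⁺ʳ; xs⊆xs++ys; xs⊆ys++xs)
open import Data.List.Relation.Unary.All as All using (All; []; _∷_)
open import Data.List.Relation.Unary.All.Properties using (++⁺; map⁺; map⁻)
open import Data.List.Relation.Unary.Any using (here; there)
open import Data.Product.Base using (∃-syntax; _×_; _,_; proj₁; proj₂)
open import Data.Sum.Base using (_⊎_; inj₁; inj₂; [_,_])
open import Data.Unit.Polymorphic.Base using (⊤)
open import Function.Bundles using (Equivalence; mk⇔)
open import Level using (Level; _⊔_)
open import Relation.Binary.PropositionalEquality.Core using (refl)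
open import Relation.Nullary.Negation.Core using (¬_)
open import Relation.Unary using (Pred; _⊆_)

open import Defs

private variable
  a ℓ p : Level
  X : Set a

module _ {Atom : Set a} where

  weaken : ∀ {Γ Γ′ : List (Formula Atom)} {A} → Γ ⊆ᴸ Γ′ → Γ ⊢ᴺ A → Γ′ ⊢ᴺ A
  weaken s (hyp i)    = hyp (s i)
  weaken s ⊤I         = ⊤I
  weaken s (∧I d e)   = ∧I (weaken s d) (weaken s e)
  weaken s (∧E₁ d)    = ∧E₁ (weaken s d)
  weaken s (∧E₂ d)    = ∧E₂ (weaken s d)
  weaken s (∨I₁ d)    = ∨I₁ (weaken s d)
  weaken s (∨I₂ d)    = ∨I₂ (weaken s d)
  weaken s (∨E d e f) = ∨E (weaken s d) (weaken (∷⁺ʳ _ s) e) (weaken (∷⁺ʳ _ s) f)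
  weaken s (⇒I d)     = ⇒I (weaken (∷⁺ʳ _ s) d)
  weaken s (⇒E d e)   = ⇒E (weaken s d) (weaken s e)
  weaken s (raa d)    = raa (weaken (∷⁺ʳ _ s) d)

  module _ {Δ : Pred (Formula Atom) ℓ} where

    axiom : ∀ {A} → Δ A → Δ ⊢ A
    axiom δ = _ , δ ∷ [] , hyp (here refl)

    ⊢-∧E₂ : ∀ {A B} → Δ ⊢ A ∧ᶠ B → Δ ⊢ B
    ⊢-∧E₂ (Γ , δs , d) = Γ , δs , ∧E₂ d

    ⊢-∧I : ∀ {A B} → Δ ⊢ A → Δ ⊢ B → Δ ⊢ A ∧ᶠ B
    ⊢-∧I (Γ , γs , d) (Θ , θs , e) =
      Γ ++ Θ , ++⁺ γs θs , ∧I (weaken (xs⊆xs++ys Γ Θ) d) (weaken (xs⊆ys++xs Θ Γ) e)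

    ⊢-⇒E : ∀ {A B} → Δ ⊢ A ⇒ᶠ B → Δ ⊢ A → Δ ⊢ B
    -- Pairing the two proofs first puts them over one common list of assumptions.
    ⊢-⇒E d e with Γ , δs , f ← ⊢-∧I d e = Γ , δs , ⇒E (∧E₁ f) (∧E₂ f)

    ⊢-⋀I : ∀ {As} → All (Δ ⊢_) As → Δ ⊢ ⋀ As
    ⊢-⋀I []       = [] , [] , ⊤I
    ⊢-⋀I (d ∷ ds) = ⊢-∧I d (⊢-⋀I ds)

module Interpretation {Atom : Set a} (F : Set ℓ) (V : Atom → Set ℓ) where

  ¬¬ᶠ : Set ℓ → Set ℓ
  ¬¬ᶠ X = (X → F) → F

  -- The Gödel-Gentzen translation: only atoms and disjunctions need an explicit `¬¬ᶠ`, since the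
  -- other connectives preserve stability.
  ⟦_⟧ : Formula Atom → Set ℓ
  ⟦ atom x ⟧ = ¬¬ᶠ (V x)
  ⟦ ⊤ᶠ ⟧     = ⊤
  ⟦ ⊥ᶠ ⟧     = F
  ⟦ A ∧ᶠ B ⟧ = ⟦ A ⟧ × ⟦ B ⟧
  ⟦ A ∨ᶠ B ⟧ = ¬¬ᶠ (⟦ A ⟧ ⊎ ⟦ B ⟧)
  ⟦ A ⇒ᶠ B ⟧ = ⟦ A ⟧ → ⟦ B ⟧

  -- This validates `raa`, and lets `∨E` reach any conclusion from a doubly negated disjunction.
  stable : ∀ A → ¬¬ᶠ ⟦ A ⟧ → ⟦ A ⟧
  stable (atom x) h = λ k → h λ m → m k
  stable ⊤ᶠ       h = _
  stable ⊥ᶠ       h = h λ f → f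
  stable (A ∧ᶠ B) h = stable A (λ k → h λ m → k (proj₁ m)) , stable B (λ k → h λ m → k (proj₂ m))
  stable (A ∨ᶠ B) h = λ k → h λ m → m k
  stable (A ⇒ᶠ B) h = λ m → stable B λ k → h λ f → k (f m)

  sound : ∀ {Γ A} → Γ ⊢ᴺ A → All ⟦_⟧ Γ → ⟦ A ⟧
  sound (hyp i)    γ = All.lookup γ i
  sound ⊤I         γ = _
  sound (∧I d e)   γ = sound d γ , sound e γ
  sound (∧E₁ d)    γ = proj₁ (sound d γ)
  sound (∧E₂ d)    γ = proj₂ (sound d γ)
  sound (∨I₁ d)    γ = λ k → k (inj₁ (sound d γ))
  sound (∨I₂ d)    γ = λ k → k (inj₂ (sound d γ))
  sound (∨E {C = C} d e f) γ =
    stable C λ k → sound d γ [ (λ m → k (sound e (m ∷ γ))) , (λ m → k (sound f (m ∷ γ))) ]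
  sound (⇒I d)     γ = λ m → sound d (m ∷ γ)
  sound (⇒E d e)   γ = sound d γ (sound e γ)
  sound (raa {A} d) γ = stable A λ k → sound d (k ∷ γ)

  sound-theory : {Δ : Pred (Formula Atom) p} → Δ ⊆ ⟦_⟧ → ∀ {A} → Δ ⊢ A → ⟦ A ⟧
  sound-theory model (_ , δs , d) = sound d (All.map model δs)

  ⟦⋀⟧⁺ : ∀ {As} → All ⟦_⟧ As → ⟦ ⋀ As ⟧
  ⟦⋀⟧⁺ []       = _
  ⟦⋀⟧⁺ (m ∷ ms) = m , ⟦⋀⟧⁺ ms

  ⟦⋀⟧⁻ : ∀ As → ⟦ ⋀ As ⟧ → All ⟦_⟧ As
  ⟦⋀⟧⁻ []       _        = []
  ⟦⋀⟧⁻ (A ∷ As) (m , ms) = m ∷ ⟦⋀⟧⁻ As ms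

  ⟦⋁⟧-elim : ∀ {As} → All (λ A → ⟦ A ⟧ → F) As → ⟦ ⋁ As ⟧ → F
  ⟦⋁⟧-elim []       m = m
  ⟦⋁⟧-elim (k ∷ ks) m = m [ k , ⟦⋁⟧-elim ks ]

  -- Double-negation shift, valid because the list is finite. Through it, finitely many attackers
  -- can be handled at once.
  All-¬¬ : {P : Pred X ℓ} → ∀ {xs} → All (λ x → ¬¬ᶠ (P x)) xs → (All P xs → F) → F
  All-¬¬ []       k = k []
  All-¬¬ (m ∷ ms) k = m λ p → All-¬¬ ms λ ps → k (p ∷ ps)

module _ {s r} (𝒜 : Network s r) where

  open Network 𝒜

  -- Unattacked arguments are the base case: they are defended vacuously.
  data Grounded (x : S) : Set (s ⊔ r) where
    defended : Defends 𝒜 Grounded x → Grounded x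

  undefend : ∀ {x} → Grounded x → Defends 𝒜 Grounded x
  undefend (defended d) = d

  AttackedByGrounded : S → Set (s ⊔ r)
  AttackedByGrounded z = ∃[ y ] Grounded y × R y z

  -- An attack of x on y yields a counterattack y′ on x from below y, then x′ on
  -- y′ from below x: an infinite descent.
  Grounded-conflictFree : ∀ {x y} → Grounded x → Grounded y → ¬ R x y
  Grounded-conflictFree {x} (defended d) (defended e) xRy =
    let y′ , g′ , y′Rx = e x xRy
        x′ , h′ , x′Ry′ = d y′ y′Rx
    in Grounded-conflictFree h′ g′ x′Ry′

  -- By induction the counterattackers lie in `E`, so `E` defends `x` and therefore contains it.
  Grounded-least : ∀ {ℓ} (E : Pred S ℓ) → IsComplete 𝒜 E → Grounded ⊆ E
  Grounded-least E c {x} (defended d) =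
    Equivalence.from (IsComplete.fixedPoint c x) λ z zRx →
      let y , g , yRz = d z zRx in y , Grounded-least E c g , yRz

  module _ (fin : Finitary 𝒜) where

    Provable : Pred S (s ⊔ r)
    Provable x = Theory 𝒜 fin ⊢CN ⟨ x ⟩

    attackers-sound : ∀ y → All (λ z → R z y) (attackers 𝒜 fin y)
    attackers-sound y = All.tabulate λ {z} i → Equivalence.to (proj₂ (fin y) z) i

    attackers-complete : ∀ {z y} → R z y → z ∈ attackers 𝒜 fin y
    attackers-complete {z} {y} = Equivalence.from (proj₂ (fin y) z)

    -- A provable counterattacker of `z` yields `𝐍 z` by `attack`; once this is done for every
    -- attacker `z` of `x`, the right-to-left half of `in-iff` gives `⟨ x ⟩`.
    Provable-defended : ∀ {x} → Defends 𝒜 Provable x → Provable x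
    Provable-defended {x} d =
      ⊢-⇒E (⊢-∧E₂ (axiom (inj₁ (in-iff x))))
        (⊢-⋀I (map⁺ (All.map
          (λ {z} zRx → let _ , p , yRz = d z zRx in ⊢-⇒E (axiom (inj₁ (attack yRz))) p)
          (attackers-sound x))))

    Grounded⇒Provable : Grounded ⊆ Provable
    Grounded⇒Provable (defended d) = Provable-defended λ z zRx →
      let y , g , yRz = d z zRx in y , Grounded⇒Provable g , yRz

    module _ (F : Set (s ⊔ r)) where

      Holds : CNAtom S → Set (s ⊔ r)
      Holds (basic q) = Grounded q
      Holds (N q)     = AttackedByGrounded q

      open Interpretation F Holds

      CNAxiom-holds : CNAxiom ⊆ ⟦_⟧
      CNAxiom-holds (N⇒¬ q) n g =
        n λ (_ , h , yRq) → g λ k → ⊥-elim (Grounded-conflictFree h k yRq)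

      Theory-holds : Theory 𝒜 fin ⊆ ⟦_⟧
      Theory-holds (unattacked u) k = k (defended λ z zRx → ⊥-elim (u z zRx))
      Theory-holds (in-iff y) =
          (λ g → ⟦⋀⟧⁺ (map⁺ (All.map
            (λ {z} zRy k → g λ h → k (undefend h z zRy)) (attackers-sound y))))
        -- Each attacker is only doubly negatedly attacked from `Grounded`; the shift extracts all
        -- these attacks together, which amounts to a defence of `y`.
        , (λ ns k → All-¬¬ (map⁻ (⟦⋀⟧⁻ _ ns)) λ as →
            k (defended λ z zRy → All.lookup as (attackers-complete zRy)))
      Theory-holds (attack {z} zRy) g k = g λ h → k (z , h , zRy)
      Theory-holds (undecided y) (outs , some) =
          -- If `y` is grounded, all its attackers are attacked from `Grounded`, which refutes every
          -- disjunct of `some`.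
          (λ g → g λ h → ⟦⋁⟧-elim (map⁺ (All.map
            (λ {z} zRy ¬n → ¬n λ k → k (undefend h z zRy)) (attackers-sound y))) some)
        -- A grounded attacker of `y` contradicts its own entry in `outs`.
        , (λ n → n λ (_ , h , zRy) →
            All.lookup (map⁻ (⟦⋀⟧⁻ _ outs)) (attackers-complete zRy) λ k → k h)

      Provable-holds : ∀ {x} → Provable x → (Grounded x → F) → F
      Provable-holds = sound-theory [ Theory-holds , CNAxiom-holds ]

    Provable⇒Grounded : Provable ⊆ Grounded
    Provable⇒Grounded {x} p = Provable-holds (Grounded x) p λ g → g

theorem8 : ∀ {s r} (𝒜 : Network s r) (fin : Finitary 𝒜) →
    IsGrounded 𝒜 (λ x → Theory 𝒜 fin ⊢CN ⟨ x ⟩)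
theorem8 𝒜 fin = record
  { complete = record
    { conflictFree = λ p q →
        Grounded-conflictFree 𝒜 (Provable⇒Grounded 𝒜 fin p) (Provable⇒Grounded 𝒜 fin q)
    ; fixedPoint = λ x → mk⇔
        -- A derivation does not display counterattackers, but membership in `Grounded` does.
        (λ p z zRx →
          let y , g , yRz = undefend 𝒜 (Provable⇒Grounded 𝒜 fin p) z zRx
          in y , Grounded⇒Provable 𝒜 fin g , yRz)
        (Provable-defended 𝒜 fin)
    }
  ; least = λ E c p → Grounded-least 𝒜 E c (Provable⇒Grounded 𝒜 fin p)
  }
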